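{- Let $\mathsf{C} \subseteq \{\mathsf{T},\mathsf{B},\mathsf{D}\}$. If a nested sequent $\mathcal{G}$ is provable in the nested sequent system $\mathsf{NIK_{t}C}$, then $\mathcal{G}$ is $\mathscr{F}_{\mathsf{C}}$-valid.
   Context: Language: formulae $A ::= p \mid \bot \mid A\lor A \mid A\land A \mid A\to A \mid \Diamond A \mid \Diamond^{ - } A \mid \Box A \mid \Box^{ - } A$, where $\Diamond,\Box$ are the forward (future) modalities and $\Diamond^{ - },\Box^{ - }$ are the backward (past) diamond and box. A frame is $(W,\le,R)$ with $W\neq\emptyset$, $\le$ a preorder, and $R\subseteq W\times W$ satisfying (F1) if $w\le w'$ and $wRv$ then there is $v'$ with $w'Rv'$ and $v\le v'$; (F2) if $wRv$ and $v\le v'$ then there is $w'$ with $w\le w'$ and $w'Rv'$. A model adds a valuation $V$ monotone along $\le$. Satisfaction: atoms by $V$; $\bot$ never; $\lor,\land$ classically at the world; $w\models A\to B$ iff for all $u\ge w$, $u\models A$ implies $u\models B$; $w\models\Diamond A$ iff some $u$ with $wRu$ has $u\models A$; $w\models\Diamond^{ - }A$ iff some $u$ with $uRw$ has $u\models A$; $w\models\Box A$ iff for all $u\ge w$ and all $v$ with $uRv$, $v\models A$; $w\models\Box^{ - }A$ iff for all $u\ge w$ and all $v$ with $vRu$, $v\models A$. $\mathscr{F}_{\mathsf{C}}$ is the class of frames whose $R$ satisfies the conditions in $\mathsf{C}$: $\mathsf{T}$ reflexivity, $\mathsf{B}$ symmetry, $\mathsf{D}$ seriality. Nested sequents: $\Gamma\vdash\Delta,(\circ_1)[\mathcal{G}_1],\dots,(\circ_n)[\mathcal{G}_n]$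 with $\Gamma,\Delta$ finite sets of formulae, $\mathcal{G}_i$ nested sequents and each $\circ_i$ either forward (f) or backward (b); this is a tree whose nodes (components, each with a unique name) are Gentzen sequents and whose edges are labelled f or b. Given a model $M$ and a map $\iota$ from components to worlds, $M,\iota\models\mathcal{G}$ iff whenever every f-edge $u\to v$ has $\iota(u)R\iota(v)$ and every b-edge $u\to v$ has $\iota(v)R\iota(u)$, some component $\Gamma\vdash\Delta$ at node $v$ has $M,\iota(v)\models\bigwedge\Gamma\to\bigvee\Delta$. $\mathcal{G}$ is $\mathscr{F}_{\mathsf{C}}$-valid iff $M,\iota\models\mathcal{G}$ for all models $M$ on frames in $\mathscr{F}_{\mathsf{C}}$ and all $\iota$. $\mathsf{NIK_{t}C}$ has initial rules $\mathsf{id}$ (some component contains $p$ on both sides) and $\bot\mathsf{L}$, standard multi-conclusion left/right rules for $\lor,\land,\to$ (with left implication keeping $A\to B$ in the left premise, and right implication, like the right box rules, deleting all consequent formulae in every component of the premise), left diamond rules creating a new f- (resp. b-)child containing $A$ on the left, right box rules creating a new f- (resp. b-)child containing $A$ on the right, propagation rules for right diamonds and left boxes that copy $A$ from a component $w$ containing the modal formula to any component $u$ with $w\twoheadrightarrow^{\mathsf{C}}_{\circ}u$ (reachability via the tree edges, their converses with flipped label, plus loops if $\mathsf{T}\in\mathsf{C}$ and flipped-label edges if $\mathsf{B}\in\mathsf{C}$), and, when $\mathsf{D}\in\mathsf{C}$, a rule $\mathsf{d}$ adding an empty f-child.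
   Formalization: Validity reads a component Γ ⊢ Δ at ι(v) as "if ι(v) satisfies ⋀Γ then it satisfies ⋁Δ"; with the intuitionistic implication ⋀Γ → ⋁Δ the claim fails, e.g. for ⊢ ◇q, (f)[q ⊢]. The two readings agree on one-component sequents. -}

module Defs where

open import Level using (Level; Lift; lift; 0ℓ; suc; _⊔_)
open import Data.Nat.Base using (ℕ)
open import Data.Bool.Base using (Bool; true; false; f≤t; b≤b)
import Data.Bool.Base as Bool
import Data.Bool.Properties as Bool
open import Data.Empty using (⊥)
import Data.Empty.Polymorphic as Poly
open import Data.List.Base using (List; []; _∷_; _++_; foldr)
open import Data.List.Membership.Propositional using (_∈_)
open import Data.List.Membership.Propositional.Properties using (∈-insert)
open import Data.List.Relation.Binary.BagAndSetEquality using (_∼[_]_; set)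
open import Data.List.Relation.Unary.Any using (here; there)
open import Data.Product.Base using (_×_; _,_; Σ-syntax; ∃-syntax)
open import Data.Sum.Base using (_⊎_; inj₁; inj₂)
open import Relation.Binary.Core using (Rel)
open import Relation.Binary.Definitions using (Reflexive; Symmetric)
open import Relation.Binary.PropositionalEquality.Core using (_≡_; refl; sym; subst)
open import Relation.Binary.Structures using (IsPreorder)
open import Relation.Nullary.Negation.Core using (¬_)
open import Relation.Unary using (Pred)
import Relation.Unary as Unary

infixr 7 _∧'_
infixr 6 _∨'_
infixr 5 _⊃_

data Formula : Set where
  atom : ℕ → Formula
  ⊥'   : Formula
  _∨'_ _∧'_ _⊃_ : Formula → Formula → Formula
  ◇ ◇⁻ □ □⁻     : Formula → Formula

⋀ ⋁ : List Formula → Formula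
⋀ = foldr _∧'_ (⊥' ⊃ ⊥')
⋁ = foldr _∨'_ ⊥'

data Axiom : Set where
  T B D : Axiom

record Frame (ℓ : Level) : Set (suc ℓ) where
  field
    W          : Set ℓ
    point      : W
    _≤_        : Rel W ℓ
    isPreorder : IsPreorder _≡_ _≤_
    R          : Rel W ℓ
    F1         : ∀ {w w′ v} → w ≤ w′ → R w v → ∃[ v′ ] (R w′ v′ × v ≤ v′)
    F2         : ∀ {w v v′} → R w v → v ≤ v′ → ∃[ w′ ] (w ≤ w′ × R w′ v′)

  Satisfies : Axiom → Set ℓ
  Satisfies T = Reflexive R
  Satisfies B = Symmetric R
  Satisfies D = ∀ w → ∃[ v ] R w v

_∈𝓕_ : ∀ {ℓ} → Frame ℓ → Pred Axiom 0ℓ → Set ℓ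
F ∈𝓕 C = ∀ c → c Unary.∈ C → Frame.Satisfies F c

record Model {ℓ} (F : Frame ℓ) : Set (suc ℓ) where
  open Frame F
  field
    V        : W → ℕ → Set ℓ
    monotone : ∀ {w w′ p} → w ≤ w′ → V w p → V w′ p

module _ {ℓ} {F : Frame ℓ} where
  open Frame F

  infix 4 _,_⊨_
  _,_⊨_ : Model F → W → Formula → Set ℓ
  M , w ⊨ atom p  = Model.V M w p
  M , w ⊨ ⊥'      = Poly.⊥
  M , w ⊨ A ∨' A′ = M , w ⊨ A ⊎ M , w ⊨ A′
  M , w ⊨ A ∧' A′ = M , w ⊨ A × M , w ⊨ A′
  M , w ⊨ A ⊃ A′  = ∀ u → w ≤ u → M , u ⊨ A → M , u ⊨ A′
  M , w ⊨ ◇ A     = ∃[ u ] (R w u × M , u ⊨ A)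
  M , w ⊨ ◇⁻ A    = ∃[ u ] (R u w × M , u ⊨ A)
  M , w ⊨ □ A     = ∀ u → w ≤ u → ∀ v → R u v → M , v ⊨ A
  M , w ⊨ □⁻ A    = ∀ u → w ≤ u → ∀ v → R v u → M , v ⊨ A

data Direction : Set where
  f b : Direction

flip : Direction → Direction
flip f = b
flip b = f

-- Γ ⊢ Δ ⟨ (d₁ , 𝒢₁) ∷ … ∷ (dₙ , 𝒢ₙ) ∷ [] ⟩ is Γ ⊢ Δ, (d₁)[𝒢₁], …, (dₙ)[𝒢ₙ].
-- The lists Γ and Δ represent finite sets: the inference rules below
-- match principal formulae up to set equality.
infix 4.5 _⊢_⟨_⟩
data NestedSequent : Set where
  _⊢_⟨_⟩ : (Γ Δ : List Formula) → List (Direction × NestedSequent) → NestedSequent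

-- Names of components are positions in the tree.
data Component : NestedSequent → Set where
  root  : ∀ {Γ Δ Ks} → Component (Γ ⊢ Δ ⟨ Ks ⟩)
  child : ∀ {Γ Δ Ks d H} → (d , H) ∈ Ks → Component H → Component (Γ ⊢ Δ ⟨ Ks ⟩)

antecedent consequent : ∀ {G} → Component G → List Formula
antecedent (root {Γ = Γ}) = Γ
antecedent (child _ u)    = antecedent u
consequent (root {Δ = Δ}) = Δ
consequent (child _ u)    = consequent u

rootOf : ∀ G → Component G
rootOf (_ ⊢ _ ⟨ _ ⟩) = root

data Edge : ∀ {G} → Direction → Component G → Component G → Set where
  top  : ∀ {Γ Δ Ks d H} (i : (d , H) ∈ Ks) →
         Edge d (root {Γ} {Δ} {Ks}) (child i (rootOf H))
  deep : ∀ {Γ Δ Ks d′ H} (i : (d′ , H) ∈ Ks) {d} {u v : Component H} →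
         Edge d u v → Edge d (child {Γ} {Δ} {Ks} i u) (child i v)

module _ {ℓ} {F : Frame ℓ} where
  open Frame F

  Related : Direction → Rel W ℓ
  Related f w v = R w v
  Related b w v = R v w

  Respects : ∀ G → (Component G → W) → Set ℓ
  Respects G ι = ∀ {d} {u v : Component G} → Edge d u v → Related d (ι u) (ι v)

  -- Γ ⊢ Δ at v is evaluated at the world ι v itself.  Evaluating the formula
  -- ⋀ Γ ⊃ ⋁ Δ at ι v instead would let different components be refuted at
  -- ≤-successors of the worlds ι v that are not related by R, and the
  -- calculus is unsound for that reading, whatever C is: see
  -- ⊃-reading-unsound.  The two readings give the same valid sequents among
  -- those with a single component.
  _⊨ⁿ_at_ : Model F → ∀ G → (Component G → W) → Set ℓ
  M ⊨ⁿ G at ι = Respects G ι →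
    ∃[ v ] (M , ι v ⊨ ⋀ (antecedent v) → M , ι v ⊨ ⋁ (consequent v))

  _⊨ⁿ⊃_at_ : Model F → ∀ G → (Component G → W) → Set ℓ
  M ⊨ⁿ⊃ G at ι = Respects G ι →
    ∃[ v ] (M , ι v ⊨ (⋀ (antecedent v) ⊃ ⋁ (consequent v)))

Valid Valid⊃ : (ℓ : Level) → Pred Axiom 0ℓ → NestedSequent → Set (suc ℓ)
Valid ℓ C G = (F : Frame ℓ) → F ∈𝓕 C → (M : Model F) →
              (ι : Component G → Frame.W F) → M ⊨ⁿ G at ι
Valid⊃ ℓ C G = (F : Frame ℓ) → F ∈𝓕 C → (M : Model F) →
               (ι : Component G → Frame.W F) → M ⊨ⁿ⊃ G at ι

-- Nested sequents with a hole in place of one subtree.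
data Context : Set where
  ∙    : Context
  nest : (Γ Δ : List Formula) (Ls : List (Direction × NestedSequent))
         (d : Direction) (𝒢 : Context) (Rs : List (Direction × NestedSequent)) →
         Context

infix 6 _⟦_⟧
_⟦_⟧ : Context → NestedSequent → NestedSequent
∙ ⟦ H ⟧                   = H
nest Γ Δ Ls d 𝒢 Rs ⟦ H ⟧ = Γ ⊢ Δ ⟨ Ls ++ (d , 𝒢 ⟦ H ⟧) ∷ Rs ⟩

hole : ∀ 𝒢 {H} → Component (𝒢 ⟦ H ⟧)
hole ∙ {H}                  = rootOf H
hole (nest Γ Δ Ls d 𝒢 Rs) = child (∈-insert Ls) (hole 𝒢)

clear  : NestedSequent → NestedSequent
clear* : List (Direction × NestedSequent) → List (Direction × NestedSequent)
clear (Γ ⊢ Δ ⟨ Ks ⟩)  = Γ ⊢ [] ⟨ clear* Ks ⟩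
clear* []             = []
clear* ((d , H) ∷ Ks) = (d , clear H) ∷ clear* Ks

clearᶜ : Context → Context
clearᶜ ∙                    = ∙
clearᶜ (nest Γ Δ Ls d 𝒢 Rs) = nest Γ [] (clear* Ls) d (clearᶜ 𝒢) (clear* Rs)

-- u may receive what w propagates along d.  This is a one-step relation:
-- no condition in C makes R transitive.
data Reach (C : Pred Axiom 0ℓ) {G : NestedSequent} :
           Direction → Component G → Component G → Set where
  edge     : ∀ {d u v} → Edge d u v → Reach C d u v
  converse : ∀ {d u v} → Edge d u v → Reach C (flip d) v u
  loop     : T Unary.∈ C → ∀ {d u} → Reach C d u u
  flipped  : B Unary.∈ C → ∀ {d u v} → Reach C d u v → Reach C (flip d) u v

infix 2 NIKₜ_▷_
data NIKₜ_▷_ (C : Pred Axiom 0ℓ) : NestedSequent → Set where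

  id : ∀ 𝒢 {Γ Δ Ks p} → atom p ∈ Γ → atom p ∈ Δ →
       NIKₜ C ▷ 𝒢 ⟦ Γ ⊢ Δ ⟨ Ks ⟩ ⟧

  ⊥L : ∀ 𝒢 {Γ Δ Ks} → ⊥' ∈ Γ →
       NIKₜ C ▷ 𝒢 ⟦ Γ ⊢ Δ ⟨ Ks ⟩ ⟧

  ∨L : ∀ 𝒢 {Γ Γ′ Δ Ks A A′} → Γ′ ∼[ set ] (A ∨' A′) ∷ Γ →
       NIKₜ C ▷ 𝒢 ⟦ A ∷ Γ ⊢ Δ ⟨ Ks ⟩ ⟧ →
       NIKₜ C ▷ 𝒢 ⟦ A′ ∷ Γ ⊢ Δ ⟨ Ks ⟩ ⟧ →
       NIKₜ C ▷ 𝒢 ⟦ Γ′ ⊢ Δ ⟨ Ks ⟩ ⟧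

  ∨R : ∀ 𝒢 {Γ Δ Δ′ Ks A A′} → Δ′ ∼[ set ] (A ∨' A′) ∷ Δ →
       NIKₜ C ▷ 𝒢 ⟦ Γ ⊢ A ∷ A′ ∷ Δ ⟨ Ks ⟩ ⟧ →
       NIKₜ C ▷ 𝒢 ⟦ Γ ⊢ Δ′ ⟨ Ks ⟩ ⟧

  ∧L : ∀ 𝒢 {Γ Γ′ Δ Ks A A′} → Γ′ ∼[ set ] (A ∧' A′) ∷ Γ →
       NIKₜ C ▷ 𝒢 ⟦ A ∷ A′ ∷ Γ ⊢ Δ ⟨ Ks ⟩ ⟧ →
       NIKₜ C ▷ 𝒢 ⟦ Γ′ ⊢ Δ ⟨ Ks ⟩ ⟧

  ∧R : ∀ 𝒢 {Γ Δ Δ′ Ks A A′} → Δ′ ∼[ set ] (A ∧' A′) ∷ Δ →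
       NIKₜ C ▷ 𝒢 ⟦ Γ ⊢ A ∷ Δ ⟨ Ks ⟩ ⟧ →
       NIKₜ C ▷ 𝒢 ⟦ Γ ⊢ A′ ∷ Δ ⟨ Ks ⟩ ⟧ →
       NIKₜ C ▷ 𝒢 ⟦ Γ ⊢ Δ′ ⟨ Ks ⟩ ⟧

  ⊃L : ∀ 𝒢 {Γ Γ′ Δ Ks A A′} → Γ′ ∼[ set ] (A ⊃ A′) ∷ Γ →
       NIKₜ C ▷ 𝒢 ⟦ (A ⊃ A′) ∷ Γ ⊢ A ∷ Δ ⟨ Ks ⟩ ⟧ →
       NIKₜ C ▷ 𝒢 ⟦ A′ ∷ Γ ⊢ Δ ⟨ Ks ⟩ ⟧ →
       NIKₜ C ▷ 𝒢 ⟦ Γ′ ⊢ Δ ⟨ Ks ⟩ ⟧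

  ⊃R : ∀ 𝒢 {Γ Δ Ks A A′} → (A ⊃ A′) ∈ Δ →
       NIKₜ C ▷ clearᶜ 𝒢 ⟦ A ∷ Γ ⊢ A′ ∷ [] ⟨ clear* Ks ⟩ ⟧ →
       NIKₜ C ▷ 𝒢 ⟦ Γ ⊢ Δ ⟨ Ks ⟩ ⟧

  ◇L : ∀ 𝒢 {Γ Γ′ Δ Ks A} → Γ′ ∼[ set ] ◇ A ∷ Γ →
       NIKₜ C ▷ 𝒢 ⟦ Γ ⊢ Δ ⟨ (f , A ∷ [] ⊢ [] ⟨ [] ⟩) ∷ Ks ⟩ ⟧ →
       NIKₜ C ▷ 𝒢 ⟦ Γ′ ⊢ Δ ⟨ Ks ⟩ ⟧

  ◇⁻L : ∀ 𝒢 {Γ Γ′ Δ Ks A} → Γ′ ∼[ set ] ◇⁻ A ∷ Γ →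
        NIKₜ C ▷ 𝒢 ⟦ Γ ⊢ Δ ⟨ (b , A ∷ [] ⊢ [] ⟨ [] ⟩) ∷ Ks ⟩ ⟧ →
        NIKₜ C ▷ 𝒢 ⟦ Γ′ ⊢ Δ ⟨ Ks ⟩ ⟧

  □R : ∀ 𝒢 {Γ Δ Ks A} → □ A ∈ Δ →
       NIKₜ C ▷ clearᶜ 𝒢 ⟦ Γ ⊢ [] ⟨ (f , [] ⊢ A ∷ [] ⟨ [] ⟩) ∷ clear* Ks ⟩ ⟧ →
       NIKₜ C ▷ 𝒢 ⟦ Γ ⊢ Δ ⟨ Ks ⟩ ⟧

  □⁻R : ∀ 𝒢 {Γ Δ Ks A} → □⁻ A ∈ Δ →
        NIKₜ C ▷ clearᶜ 𝒢 ⟦ Γ ⊢ [] ⟨ (b , [] ⊢ A ∷ [] ⟨ [] ⟩) ∷ clear* Ks ⟩ ⟧ →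
        NIKₜ C ▷ 𝒢 ⟦ Γ ⊢ Δ ⟨ Ks ⟩ ⟧

  ◇R : ∀ 𝒢 {Γ Δ Ks A} (w : Component (𝒢 ⟦ Γ ⊢ Δ ⟨ Ks ⟩ ⟧)) →
       ◇ A ∈ consequent w → Reach C f w (hole 𝒢) →
       NIKₜ C ▷ 𝒢 ⟦ Γ ⊢ A ∷ Δ ⟨ Ks ⟩ ⟧ →
       NIKₜ C ▷ 𝒢 ⟦ Γ ⊢ Δ ⟨ Ks ⟩ ⟧

  ◇⁻R : ∀ 𝒢 {Γ Δ Ks A} (w : Component (𝒢 ⟦ Γ ⊢ Δ ⟨ Ks ⟩ ⟧)) →
        ◇⁻ A ∈ consequent w → Reach C b w (hole 𝒢) →
        NIKₜ C ▷ 𝒢 ⟦ Γ ⊢ A ∷ Δ ⟨ Ks ⟩ ⟧ →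
        NIKₜ C ▷ 𝒢 ⟦ Γ ⊢ Δ ⟨ Ks ⟩ ⟧

  □L : ∀ 𝒢 {Γ Δ Ks A} (w : Component (𝒢 ⟦ Γ ⊢ Δ ⟨ Ks ⟩ ⟧)) →
       □ A ∈ antecedent w → Reach C f w (hole 𝒢) →
       NIKₜ C ▷ 𝒢 ⟦ A ∷ Γ ⊢ Δ ⟨ Ks ⟩ ⟧ →
       NIKₜ C ▷ 𝒢 ⟦ Γ ⊢ Δ ⟨ Ks ⟩ ⟧

  □⁻L : ∀ 𝒢 {Γ Δ Ks A} (w : Component (𝒢 ⟦ Γ ⊢ Δ ⟨ Ks ⟩ ⟧)) →
        □⁻ A ∈ antecedent w → Reach C b w (hole 𝒢) →
        NIKₜ C ▷ 𝒢 ⟦ A ∷ Γ ⊢ Δ ⟨ Ks ⟩ ⟧ →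
        NIKₜ C ▷ 𝒢 ⟦ Γ ⊢ Δ ⟨ Ks ⟩ ⟧

  d-rule : D Unary.∈ C → ∀ 𝒢 {Γ Δ Ks} →
           NIKₜ C ▷ 𝒢 ⟦ Γ ⊢ Δ ⟨ (f , [] ⊢ [] ⟨ [] ⟩) ∷ Ks ⟩ ⟧ →
           NIKₜ C ▷ 𝒢 ⟦ Γ ⊢ Δ ⟨ Ks ⟩ ⟧

-- The sequent ⊢ ◇ q, (f)[ q ⊢ ] is provable.  On the two-element chain with
-- R the identity and q true at the top only, map both components to the
-- bottom: ◇ q fails there, and so does q ⊃ ⊥', because of the top.
⊃-reading-unsound : ∀ C → ¬ (∀ G → NIKₜ C ▷ G → Valid⊃ 0ℓ C G)
⊃-reading-unsound C sound = refuted (sound G provable F F∈ M (λ _ → false) respects)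
  where
  q = atom 0

  G : NestedSequent
  G = [] ⊢ ◇ q ∷ [] ⟨ (f , q ∷ [] ⊢ [] ⟨ [] ⟩) ∷ [] ⟩

  provable : NIKₜ C ▷ G
  provable = ◇R 𝒢 root (here refl) (edge (top (here refl))) (id 𝒢 (here refl) (here refl))
    where 𝒢 = nest [] (◇ q ∷ []) [] f ∙ []

  F : Frame 0ℓ
  F = record
    { W = Bool ; point = false ; _≤_ = Bool._≤_ ; isPreorder = Bool.≤-isPreorder
    ; R = _≡_
    ; F1 = λ { w≤w′ refl → _ , refl , w≤w′ }
    ; F2 = λ { refl v≤v′ → _ , v≤v′ , refl } }

  F∈ : F ∈𝓕 C
  F∈ T _ = refl
  F∈ B _ = sym
  F∈ D _ = λ w → w , refl

  M : Model F
  M = record { V = λ w _ → w ≡ true ; monotone = λ { b≤b e → e ; f≤t _ → refl } }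

  respects : Respects {F = F} G (λ _ → false)
  respects {f} _ = refl
  respects {b} _ = refl

  refuted : ¬ (∃[ v ] (M , false ⊨ (⋀ (antecedent {G} v) ⊃ ⋁ (consequent v))))
  refuted (root , h) with h false b≤b (λ _ _ x → x)
  ... | inj₁ (false , _ , ())
  ... | inj₁ (true , () , _)
  ... | inj₂ (lift ())
  refuted (child (here refl) root , h) with h true f≤t (refl , λ _ _ x → x)
  ... | lift ()

{-# OPTIONS --safe #-}

-- If every component of G fails at its world ι v, then antecedents are forced
-- and consequents are not, all along the tree: G is refuted.  No derivable
-- sequent is refuted, because each rule carries a refutation of its conclusion
-- to one of some premise.  For ⊃R, □R and □⁻R the principal component has to
-- move to a ≤-larger world; F1 and F2 then let all other worlds move up along
-- the tree, which preserves antecedents but not consequents, whence the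
-- deletion of consequents in these rules.

module Submission where

open import Defs
open import Level using (0ℓ; lift)
open import Axiom.ExcludedMiddle using (ExcludedMiddle)
open import Axiom.DoubleNegationElimination using (em⇒dne)
open import Data.Empty using (⊥-elim)
open import Data.List.Base using (List; []; _∷_; _++_)
open import Data.List.Membership.Propositional using (_∈_)
open import Data.List.Membership.Propositional.Properties using (∈-insert)
open import Data.List.Relation.Binary.BagAndSetEquality using (_∼[_]_; set)
open import Data.List.Relation.Unary.All using (All; []; _∷_; lookup; tabulate)
open import Data.List.Relation.Unary.All.Properties using (++⁺; ++⁻; anti-mono)
open import Data.List.Relation.Unary.Any using (here; there)
open import Data.Product.Base using (_×_; _,_; proj₁; proj₂; ∃-syntax)
open import Data.Sum.Base using (inj₁; inj₂)
open import Function.Bundles using (module Equivalence)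
open import Relation.Binary.PropositionalEquality.Core using (refl)
open import Relation.Binary.Structures using (IsPreorder)
open import Relation.Nullary.Negation.Core using (¬_)
open import Relation.Unary using (Pred)

All-∼ : ∀ {a p} {A : Set a} {P : Pred A p} {xs ys} → xs ∼[ set ] ys → All P xs → All P ys
All-∼ xs∼ys = anti-mono (Equivalence.from xs∼ys)

replaceAt : ∀ {a p} {A : Set a} {P : Pred A p} xs {x y zs} →
            All P (xs ++ x ∷ zs) → P y → All P (xs ++ y ∷ zs)
replaceAt xs ps py with ++⁻ xs ps
... | pxs , _ ∷ pzs = ++⁺ pxs (py ∷ pzs)

module _ {ℓ} {F : Frame ℓ} where
  open Frame F
  open IsPreorder isPreorder using () renaming (refl to ≤-refl; trans to ≤-trans)

  private
    Rel[_] : Direction → W → W → Set ℓ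
    Rel[_] = Related {F = F}

  Related-flip : ∀ d {w v} → Rel[ d ] w v → Rel[ flip d ] v w
  Related-flip f wRv = wRv
  Related-flip b vRw = vRw

  -- F2 is F1 for the converse of `R`, with the two components of the pair swapped. Stated by
  -- direction, both frame conditions become one confluence property.
  Related-raiseˡ : ∀ d {w w′ v} → w ≤ w′ → Rel[ d ] w v → ∃[ v′ ] (Rel[ d ] w′ v′ × v ≤ v′)
  Related-raiseˡ f w≤w′ wRv = F1 w≤w′ wRv
  Related-raiseˡ b w≤w′ vRw with F2 vRw w≤w′
  ... | v′ , v≤v′ , v′Rw′ = v′ , v′Rw′ , v≤v′

  Related-raiseʳ : ∀ d {w v v′} → v ≤ v′ → Rel[ d ] w v → ∃[ w′ ] (Rel[ d ] w′ v′ × w ≤ w′)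
  Related-raiseʳ f v≤v′ wRv = Related-raiseˡ b v≤v′ wRv
  Related-raiseʳ b v≤v′ vRw = Related-raiseˡ f v≤v′ vRw

  module _ (M : Model F) where

    -- The clauses for `⊃`, `□` and `□⁻` quantify over larger worlds, so transitivity is enough. The
    -- diamonds have no such quantifier: `◇` needs F1 and `◇⁻` needs F2.
    ⊨-mono : ∀ A {w w′} → w ≤ w′ → M , w ⊨ A → M , w′ ⊨ A
    ⊨-mono (atom p) w≤w′ x = Model.monotone M w≤w′ x
    ⊨-mono ⊥' w≤w′ (lift ())
    ⊨-mono (A ∨' A′) w≤w′ (inj₁ x) = inj₁ (⊨-mono A w≤w′ x)
    ⊨-mono (A ∨' A′) w≤w′ (inj₂ y) = inj₂ (⊨-mono A′ w≤w′ y)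
    ⊨-mono (A ∧' A′) w≤w′ (x , y) = ⊨-mono A w≤w′ x , ⊨-mono A′ w≤w′ y
    ⊨-mono (A ⊃ A′) w≤w′ h u w′≤u = h u (≤-trans w≤w′ w′≤u)
    ⊨-mono (◇ A) w≤w′ (u , wRu , x) with Related-raiseˡ f w≤w′ wRu
    ... | u′ , w′Ru′ , u≤u′ = u′ , w′Ru′ , ⊨-mono A u≤u′ x
    ⊨-mono (◇⁻ A) w≤w′ (u , uRw , x) with Related-raiseˡ b w≤w′ uRw
    ... | u′ , u′Rw′ , u≤u′ = u′ , u′Rw′ , ⊨-mono A u≤u′ x
    ⊨-mono (□ A) w≤w′ h u w′≤u = h u (≤-trans w≤w′ w′≤u)
    ⊨-mono (□⁻ A) w≤w′ h u w′≤u = h u (≤-trans w≤w′ w′≤u)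

    ⋀⇒All : ∀ Γ {w} → M , w ⊨ ⋀ Γ → All (λ A → M , w ⊨ A) Γ
    ⋀⇒All []      _        = []
    ⋀⇒All (A ∷ Γ) (x , xs) = x ∷ ⋀⇒All Γ xs

    ∈⇒⋁ : ∀ {Δ w A} → A ∈ Δ → M , w ⊨ A → M , w ⊨ ⋁ Δ
    ∈⇒⋁ (here refl) x = inj₁ x
    ∈⇒⋁ (there i)   x = inj₂ (∈⇒⋁ i x)

    Forced Unforced : W → List Formula → Set ℓ
    Forced   w = All (λ A → M , w ⊨ A)
    Unforced w = All (λ A → ¬ M , w ⊨ A)

    Forced-mono : ∀ {Γ w w′} → w ≤ w′ → Forced w Γ → Forced w′ Γ
    Forced-mono w≤w′ []              = []
    Forced-mono w≤w′ (_∷_ {A} x xs) = ⊨-mono A w≤w′ x ∷ Forced-mono w≤w′ xs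

    -- The worlds are stored along the tree, not as a function on `Component`. Changing or adding a
    -- subtree is then a local replacement, with no transport of positions.
    data Refutes (w : W) : NestedSequent → Set ℓ
    RefutesBelow : W → List (Direction × NestedSequent) → Set ℓ
    data Refutes w where
      refutes : ∀ {Γ Δ Ks} → Forced w Γ → Unforced w Δ → RefutesBelow w Ks →
                Refutes w (Γ ⊢ Δ ⟨ Ks ⟩)
    RefutesBelow w = All (λ K → ∃[ v ] (Rel[ proj₁ K ] w v × Refutes v (proj₂ K)))

    world : ∀ {G w} → Refutes w G → Component G → W
    world {w = w} (refutes _ _ _) root = w
    world (refutes _ _ κ) (child i u)  = world (proj₂ (proj₂ (lookup κ i))) u

    antecedent-forced : ∀ {G w} (r : Refutes w G) u → Forced (world r u) (antecedent u)
    antecedent-forced (refutes γ _ _) root        = γ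
    antecedent-forced (refutes _ _ κ) (child i u) = antecedent-forced (proj₂ (proj₂ (lookup κ i))) u

    consequent-unforced : ∀ {G w} (r : Refutes w G) u → Unforced (world r u) (consequent u)
    consequent-unforced (refutes _ δ _) root        = δ
    consequent-unforced (refutes _ _ κ) (child i u) = consequent-unforced (proj₂ (proj₂ (lookup κ i))) u

    Related-rootOf : ∀ {G d w v} → Rel[ d ] w v → (r : Refutes v G) → Rel[ d ] w (world r (rootOf G))
    Related-rootOf wRv (refutes _ _ _) = wRv

    world-respects : ∀ {G w} (r : Refutes w G) {d u v} → Edge d u v → Rel[ d ] (world r u) (world r v)
    world-respects (refutes _ _ κ) {d} (top i) with lookup κ i
    ... | _ , wRv , r = Related-rootOf {d = d} wRv r
    world-respects (refutes _ _ κ) (deep i e) = world-respects (proj₂ (proj₂ (lookup κ i))) e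

    -- Tree edges and their converses hold by construction of `r`; loops use reflexivity and flipped
    -- labels symmetry. The splits on `d` only let `Related` compute.
    reach-related : ∀ {C} → F ∈𝓕 C → ∀ {G w} (r : Refutes w G) {d u v} →
                    Reach C d u v → Rel[ d ] (world r u) (world r v)
    reach-related F∈ r (edge e)             = world-respects r e
    reach-related F∈ r (converse {d = d} e) = Related-flip d (world-respects r e)
    reach-related F∈ r (loop t {d = f})     = F∈ T t
    reach-related F∈ r (loop t {d = b})     = F∈ T t
    reach-related F∈ r (flipped s {d = f} p) = F∈ B s (reach-related F∈ r p)
    reach-related F∈ r (flipped s {d = b} p) = F∈ B s (reach-related F∈ r p)

    focus : ∀ 𝒢 {H w} (r : Refutes w (𝒢 ⟦ H ⟧)) → Refutes (world r (hole 𝒢)) H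
    focus ∙ r@(refutes _ _ _) = r
    focus (nest _ _ Ls _ 𝒢 _) (refutes _ _ κ) = focus 𝒢 (proj₂ (proj₂ (lookup κ (∈-insert Ls))))

    -- The new subtree sits at the same world as the old one, so the edge into the hole survives and
    -- all other components stay fixed.
    plug : ∀ 𝒢 {H H′ w} (r : Refutes w (𝒢 ⟦ H ⟧)) → Refutes (world r (hole 𝒢)) H′ → Refutes w (𝒢 ⟦ H′ ⟧)
    plug ∙ (refutes _ _ _) r′ = r′
    plug (nest _ _ Ls _ 𝒢 _) (refutes γ δ κ) r′ with lookup κ (∈-insert Ls)
    ... | v , wRv , r = refutes γ δ (replaceAt Ls κ (v , wRv , plug 𝒢 r r′))

    raise  : ∀ {G w w′} → w ≤ w′ → Refutes w G → Refutes w′ (clear G)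
    raise* : ∀ {Ks w w′} → w ≤ w′ → RefutesBelow w Ks → RefutesBelow w′ (clear* Ks)
    raise w≤w′ (refutes γ _ κ) = refutes (Forced-mono w≤w′ γ) [] (raise* w≤w′ κ)
    raise* w≤w′ [] = []
    raise* {(d , _) ∷ _} w≤w′ ((_ , wRv , r) ∷ κ) with Related-raiseˡ d w≤w′ wRv
    ... | v′ , w′Rv′ , v≤v′ = (v′ , w′Rv′ , raise v≤v′ r) ∷ raise* w≤w′ κ

    -- The upward move travels from the hole to the root by `Related-raiseʳ`, and from each node
    -- passed it descends into the side subtrees by `raise*`. The frame conditions choose each new
    -- ancestor, so `w′` cannot be prescribed.
    raise-plug : ∀ 𝒢 {H H′ w v′} (r : Refutes w (𝒢 ⟦ H ⟧)) →
                 world r (hole 𝒢) ≤ v′ → Refutes v′ H′ →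
                 ∃[ w′ ] (w ≤ w′ × Refutes w′ (clearᶜ 𝒢 ⟦ H′ ⟧))
    raise-plug ∙ (refutes _ _ _) w≤w′ r′ = _ , w≤w′ , r′
    raise-plug (nest _ _ Ls d 𝒢 _) (refutes γ _ κ) h≤v′ r′
      with lookup κ (∈-insert Ls) | ++⁻ Ls κ
    ... | _ , wRv , r | κˡ , _ ∷ κʳ with raise-plug 𝒢 r h≤v′ r′
    ... | v′ , v≤v′ , s with Related-raiseʳ d v≤v′ wRv
    ... | w′ , w′Rv′ , w≤w′ = w′ , w≤w′ ,
      refutes (Forced-mono w≤w′ γ) []
        (++⁺ (raise* w≤w′ κˡ) ((v′ , w′Rv′ , s) ∷ raise* w≤w′ κʳ))

    assignment⇒refutes : ∀ G (ι : Component G → W) → Respects {F = F} G ι →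
      (∀ v → Forced (ι v) (antecedent v)) → (∀ v → Unforced (ι v) (consequent v)) →
      Refutes (ι (rootOf G)) G
    -- Indexing `ι` by membership proofs lets the induction on `Ks` pass to the tail by precomposing
    -- with `there`.
    assignment⇒refutesBelow : ∀ w Ks (ι : ∀ {d H} → (d , H) ∈ Ks → Component H → W) →
      (∀ {d H} (i : (d , H) ∈ Ks) → Rel[ d ] w (ι i (rootOf H)) × Respects {F = F} H (ι i)) →
      (∀ {d H} (i : (d , H) ∈ Ks) v → Forced (ι i v) (antecedent v)) →
      (∀ {d H} (i : (d , H) ∈ Ks) v → Unforced (ι i v) (consequent v)) →
      RefutesBelow w Ks
    assignment⇒refutes (Γ ⊢ Δ ⟨ Ks ⟩) ι ρ γ δ = refutes (γ root) (δ root)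
      (assignment⇒refutesBelow (ι root) Ks (λ i u → ι (child i u))
        (λ i → ρ (top i) , λ e → ρ (deep i e))
        (λ i u → γ (child i u)) (λ i u → δ (child i u)))
    assignment⇒refutesBelow w [] ι ρ γ δ = []
    assignment⇒refutesBelow w ((d , H) ∷ Ks) ι ρ γ δ =
      (ι i (rootOf H) , proj₁ (ρ i) , assignment⇒refutes H (ι i) (proj₂ (ρ i)) (γ i) (δ i)) ∷
      assignment⇒refutesBelow w Ks (λ j → ι (there j)) (λ j → ρ (there j))
        (λ j → γ (there j)) (λ j → δ (there j))
      where
      i : (d , H) ∈ (d , H) ∷ Ks
      i = here refl

    module _ (em : ExcludedMiddle ℓ) where

      private
        dne : {P : Set ℓ} → ¬ ¬ P → P
        dne = em⇒dne em

      -- Classical reasoning enters only at `⊃R`, `□R` and `□⁻R`, where a formula is forced because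
      -- its failure would refute the premise.
      derivable⇒¬refuted : ∀ {C} → F ∈𝓕 C → ∀ {G} → NIKₜ C ▷ G → ∀ {w} → ¬ Refutes w G
      derivable⇒¬refuted {C} F∈ = go
        where
        go : ∀ {G} → NIKₜ C ▷ G → ∀ {w} → ¬ Refutes w G
        go (id 𝒢 i j) r with focus 𝒢 r
        ... | refutes γ δ _ = lookup δ j (lookup γ i)
        go (⊥L 𝒢 i) r with focus 𝒢 r
        ... | refutes γ _ _ with lookup γ i
        ... | lift ()
        go (∨L 𝒢 eq p q) r with focus 𝒢 r
        ... | refutes γ δ κ with All-∼ eq γ
        ... | inj₁ x ∷ γ′ = go p (plug 𝒢 r (refutes (x ∷ γ′) δ κ))
        ... | inj₂ y ∷ γ′ = go q (plug 𝒢 r (refutes (y ∷ γ′) δ κ))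
        go (∨R 𝒢 eq p) r with focus 𝒢 r
        ... | refutes γ δ κ with All-∼ eq δ
        ... | n ∷ δ′ = go p (plug 𝒢 r (refutes γ ((λ x → n (inj₁ x)) ∷ (λ y → n (inj₂ y)) ∷ δ′) κ))
        go (∧L 𝒢 eq p) r with focus 𝒢 r
        ... | refutes γ δ κ with All-∼ eq γ
        ... | (x , y) ∷ γ′ = go p (plug 𝒢 r (refutes (x ∷ y ∷ γ′) δ κ))
        go (∧R 𝒢 eq p q) r with focus 𝒢 r
        ... | refutes γ δ κ with All-∼ eq δ
        ... | n ∷ δ′ =
          -- It is not decided which conjunct fails: a proof `x` of the first would let the second
          -- premise be refuted, so the first conjunct is unforced.
          go p (plug 𝒢 r (refutes γ ((λ x →
          go q (plug 𝒢 r (refutes γ ((λ y → n (x , y)) ∷ δ′) κ))) ∷ δ′) κ))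
        go (⊃L 𝒢 eq p q) r with focus 𝒢 r
        ... | refutes γ δ κ with All-∼ eq γ
        ... | h ∷ γ′ =
          go p (plug 𝒢 r (refutes (h ∷ γ′) ((λ x →
          go q (plug 𝒢 r (refutes (h _ ≤-refl x ∷ γ′) δ κ))) ∷ δ) κ))
        go (⊃R 𝒢 i p) r with focus 𝒢 r
        -- The implication is shown to be forced after all: at any `u` above the hole's world where
        -- its left side holds, failure `n` of its right side refutes the premise with the hole
        -- moved to `u`.
        ... | refutes γ δ κ = lookup δ i λ u w≤u x → dne λ n →
          let _ , _ , s = raise-plug 𝒢 r w≤u
                            (refutes (x ∷ Forced-mono w≤u γ) (n ∷ []) (raise* w≤u κ))
          in go p s
        go (◇L 𝒢 eq p) r with focus 𝒢 r
        ... | refutes γ δ κ with All-∼ eq γ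
        ... | (v , wRv , x) ∷ γ′ =
          go p (plug 𝒢 r (refutes γ′ δ ((v , wRv , refutes (x ∷ []) [] []) ∷ κ)))
        go (◇⁻L 𝒢 eq p) r with focus 𝒢 r
        ... | refutes γ δ κ with All-∼ eq γ
        ... | (v , vRw , x) ∷ γ′ =
          go p (plug 𝒢 r (refutes γ′ δ ((v , vRw , refutes (x ∷ []) [] []) ∷ κ)))
        go (□R 𝒢 i p) r with focus 𝒢 r
        -- The fresh child is placed at `v`, a successor of the raised world `u` and not necessarily
        -- of the original one.
        ... | refutes γ δ κ = lookup δ i λ u w≤u v uRv → dne λ n →
          let _ , _ , s = raise-plug 𝒢 r w≤u
                            (refutes (Forced-mono w≤u γ) []
                              ((v , uRv , refutes [] (n ∷ []) []) ∷ raise* w≤u κ))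
          in go p s
        go (□⁻R 𝒢 i p) r with focus 𝒢 r
        ... | refutes γ δ κ = lookup δ i λ u w≤u v vRu → dne λ n →
          let _ , _ , s = raise-plug 𝒢 r w≤u
                            (refutes (Forced-mono w≤u γ) []
                              ((v , vRu , refutes [] (n ∷ []) []) ∷ raise* w≤u κ))
          in go p s
        go (◇R 𝒢 u i ρ p) r with focus 𝒢 r
        ... | refutes γ δ κ = go p (plug 𝒢 r (refutes γ ((λ x →
          lookup (consequent-unforced r u) i (_ , reach-related F∈ r ρ , x)) ∷ δ) κ))
        go (◇⁻R 𝒢 u i ρ p) r with focus 𝒢 r
        ... | refutes γ δ κ = go p (plug 𝒢 r (refutes γ ((λ x →
          lookup (consequent-unforced r u) i (_ , reach-related F∈ r ρ , x)) ∷ δ) κ))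
        go (□L 𝒢 u i ρ p) r with focus 𝒢 r
        ... | refutes γ δ κ = go p (plug 𝒢 r (refutes
          (lookup (antecedent-forced r u) i _ ≤-refl _ (reach-related F∈ r ρ) ∷ γ) δ κ))
        go (□⁻L 𝒢 u i ρ p) r with focus 𝒢 r
        ... | refutes γ δ κ = go p (plug 𝒢 r (refutes
          (lookup (antecedent-forced r u) i _ ≤-refl _ (reach-related F∈ r ρ) ∷ γ) δ κ))
        go (d-rule s 𝒢 p) r with focus 𝒢 r
        ... | refutes γ δ κ with F∈ D s (world r (hole 𝒢))
        ... | v , wRv = go p (plug 𝒢 r (refutes γ δ ((v , wRv , refutes [] [] []) ∷ κ)))

      ¬refuted⇒⊨ⁿ : ∀ {G} → (∀ {w} → ¬ Refutes w G) → ∀ ι → M ⊨ⁿ G at ι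
      ¬refuted⇒⊨ⁿ ¬r ι ρ = dne λ ¬∃ → ¬r (assignment⇒refutes _ ι ρ
        -- If `⋀` of the antecedent failed at `ι v`, the implication there would hold vacuously,
        -- against `¬∃`.
        (λ v → ⋀⇒All (antecedent v) (dne λ ¬⋀ → ¬∃ (v , λ ⋀Γ → ⊥-elim (¬⋀ ⋀Γ))))
        (λ v → tabulate λ i x → ¬∃ (v , λ _ → ∈⇒⋁ i x)))

mainTheorem1 : ∀ {ℓ} → ExcludedMiddle ℓ → (C : Pred Axiom 0ℓ) (G : NestedSequent) → NIKₜ C ▷ G → Valid ℓ C G
mainTheorem1 em C G π F F∈ M = ¬refuted⇒⊨ⁿ M em (derivable⇒¬refuted M em F∈ π)
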